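{- Let $F$ be a field of characteristic $0$ and let $n$ be an even positive integer. Let $s_n=n\times\langle1\rangle$ be the sum-of-squares form $x_1^2+\dots+x_n^2$ on $F^n$. Then $$\omega(\mathcal G_{s_n,1})=\begin{cases}n,&\text{if }n+1\text{ is not a square in }F,\\ n+1,&\text{otherwise.}\end{cases}$$
   Context: For a quadratic form $q$ on an $F$-vector space $V$ and $a\in F$, $\mathcal G_{q,a}$ is the graph with vertex set $V$ and edge set $\{\{x,y\}\mid x\ne y,\ q(x-y)=a\}$; $\omega$ denotes the clique number (size of a largest clique). -}

module Defs where

open import Algebra.Bundles using (AbelianGroup; CommutativeRing)
open import Algebra.Definitions using (Invertible)
open import Algebra.Module.Bundles using (Module)
open import Algebra.Module.Structures.Biased using (IsModuleFromLeft)
import Algebra.Construct.Pointwise as Pointwise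
import Algebra.Definitions.RawMonoid as RawMonoidDefs
import Algebra.Properties.AbelianGroup as AbelianGroupProperties
import Algebra.Properties.Ring as RingProperties
import Algebra.Properties.Semiring.Sum as SemiringSum
import Algebra.Solver.Ring.NaturalCoefficients.Default as SemiringSolver
open import Data.Fin.Base using (Fin; zero; suc)
open import Data.Nat.Base using (ℕ; zero; suc; _≤_)
open import Data.Product.Base using (∃-syntax; _×_; _,_)
open import Data.Vec.Functional using (Vector)
open import Function.Base using (_∘_)
open import Level using (Level; _⊔_) renaming (suc to lsuc)
open import Relation.Binary.Bundles using (Setoid)
open import Relation.Binary.Core using (Rel)
open import Relation.Binary.PropositionalEquality.Core using (_≡_; _≢_)
import Relation.Binary.Reasoning.Setoid as SetoidReasoning
open import Relation.Nullary.Negation using (¬_)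

private
  variable
    c ℓ m ℓm : Level

-- The textbook notion, with inequality as plain negation. The library's
-- HeytingField instead takes an apartness relation as an additional datum.

record Field c ℓ : Set (lsuc (c ⊔ ℓ)) where
  field
    commutativeRing : CommutativeRing c ℓ

  open CommutativeRing commutativeRing public

  field
    0≉1        : 0# ≉ 1#
    invertible : ∀ {x} → x ≉ 0# → Invertible _≈_ 1# _*_ x

module _ (F : Field c ℓ) where
  open Field F

  natural : ℕ → Carrier
  natural k = RawMonoidDefs._×_ +-rawMonoid k 1#

  HasCharacteristicZero : Set ℓ
  HasCharacteristicZero = ∀ k → natural k ≈ 0# → k ≡ 0

  IsSquare : Carrier → Set (c ⊔ ℓ)
  IsSquare a = ∃[ b ] b * b ≈ a

  VectorSpace : ∀ m ℓm → Set (c ⊔ ℓ ⊔ lsuc (m ⊔ ℓm))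
  VectorSpace = Module commutativeRing

-- The polar form is symmetric by construction, so linearity in its first
-- argument is bilinearity.

record QuadraticForm (F : Field c ℓ) (V : VectorSpace F m ℓm)
                     : Set (c ⊔ ℓ ⊔ m ⊔ ℓm) where
  open Field F
  open Module V using (Carrierᴹ; _≈ᴹ_; _+ᴹ_; _*ₗ_)

  field
    ⟦_⟧ : Carrierᴹ → Carrier

  polar : Carrierᴹ → Carrierᴹ → Carrier
  polar x y = ⟦ x +ᴹ y ⟧ - ⟦ x ⟧ - ⟦ y ⟧

  field
    cong        : ∀ {x y} → x ≈ᴹ y → ⟦ x ⟧ ≈ ⟦ y ⟧
    homogeneous : ∀ a x → ⟦ a *ₗ x ⟧ ≈ a * a * ⟦ x ⟧
    polar-+     : ∀ x y z → polar (x +ᴹ y) z ≈ polar x z + polar y z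
    polar-*     : ∀ a x y → polar (a *ₗ x) y ≈ a * polar x y

record Graph v ℓv e : Set (lsuc (v ⊔ ℓv ⊔ e)) where
  field
    vertices : Setoid v ℓv

  open Setoid vertices public using () renaming (Carrier to Vertex; _≈_ to _≈ⱽ_)

  field
    Adjacent : Rel Vertex e
    resp     : ∀ {x x′ y y′} → x ≈ⱽ x′ → y ≈ⱽ y′ → Adjacent x y → Adjacent x′ y′
    sym      : ∀ {x y} → Adjacent x y → Adjacent y x
    irrefl   : ∀ {x y} → x ≈ⱽ y → ¬ Adjacent x y

module _ {v ℓv e} (G : Graph v ℓv e) where
  open Graph G

  -- Adjacency is irreflexive, so the k enumerated vertices are distinct.

  record Clique (k : ℕ) : Set (v ⊔ e) where
    field
      vertex   : Fin k → Vertex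
      adjacent : ∀ {i j} → i ≢ j → Adjacent (vertex i) (vertex j)

  -- An infinite clique contains finite cliques of every size, so the bound
  -- also rules out infinite cliques.

  IsCliqueNumber : ℕ → Set (v ⊔ e)
  IsCliqueNumber k = Clique k × (∀ {l} → Clique l → l ≤ k)

module _ (F : Field c ℓ) {V : VectorSpace F m ℓm} where
  open Field F
  open Module V

  private
    open AbelianGroupProperties +ᴹ-abelianGroup using (⁻¹-anti-homo‿-; inverseˡ-unique)
    open RingProperties ring using (-1*x≈-x; -‿involutive)

    -1*ₗ : ∀ x → (- 1#) *ₗ x ≈ᴹ -ᴹ x
    -1*ₗ x = inverseˡ-unique _ _ (begin
      (- 1#) *ₗ x +ᴹ x           ≈⟨ +ᴹ-cong ≈ᴹ-refl (≈ᴹ-sym (*ₗ-identityˡ x)) ⟩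
      (- 1#) *ₗ x +ᴹ 1# *ₗ x     ≈⟨ ≈ᴹ-sym (*ₗ-distribʳ x (- 1#) 1#) ⟩
      (- 1# + 1#) *ₗ x           ≈⟨ *ₗ-cong (-‿inverseˡ 1#) ≈ᴹ-refl ⟩
      0# *ₗ x                    ≈⟨ *ₗ-zeroˡ x ⟩
      0ᴹ                         ∎)
      where open SetoidReasoning ≈ᴹ-setoid

    -‿swap : (q : QuadraticForm F V) → let open QuadraticForm q in
           ∀ x y → ⟦ x +ᴹ -ᴹ y ⟧ ≈ ⟦ y +ᴹ -ᴹ x ⟧
    -‿swap q x y = begin
      ⟦ x +ᴹ -ᴹ y ⟧                      ≈⟨ cong (≈ᴹ-sym (⁻¹-anti-homo‿- y x)) ⟩
      ⟦ -ᴹ (y +ᴹ -ᴹ x) ⟧                 ≈⟨ cong (≈ᴹ-sym (-1*ₗ _)) ⟩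
      ⟦ (- 1#) *ₗ (y +ᴹ -ᴹ x) ⟧          ≈⟨ homogeneous _ _ ⟩
      (- 1#) * (- 1#) * ⟦ y +ᴹ -ᴹ x ⟧    ≈⟨ *-congʳ (-1*x≈-x (- 1#)) ⟩
      - (- 1#) * ⟦ y +ᴹ -ᴹ x ⟧           ≈⟨ *-congʳ (-‿involutive 1#) ⟩
      1# * ⟦ y +ᴹ -ᴹ x ⟧                 ≈⟨ *-identityˡ _ ⟩
      ⟦ y +ᴹ -ᴹ x ⟧                      ∎
      where
      open QuadraticForm q
      open SetoidReasoning setoid

  𝒢 : QuadraticForm F V → Carrier → Graph m ℓm (ℓ ⊔ ℓm)
  𝒢 q a = record
    { vertices = ≈ᴹ-setoid
    ; Adjacent = λ x y → ¬ (x ≈ᴹ y) × ⟦ x +ᴹ -ᴹ y ⟧ ≈ a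
    ; resp     = λ x≈x′ y≈y′ (x≉y , e) →
        (λ x′≈y′ → x≉y (≈ᴹ-trans x≈x′ (≈ᴹ-trans x′≈y′ (≈ᴹ-sym y≈y′)))) ,
        trans (cong (≈ᴹ-sym (+ᴹ-cong x≈x′ (-ᴹ‿cong y≈y′)))) e
    ; sym      = λ (x≉y , e) → (λ y≈x → x≉y (≈ᴹ-sym y≈x)) , trans (-‿swap q _ _) e
    ; irrefl   = λ x≈y (x≉y , _) → x≉y x≈y
    }
    where open QuadraticForm q

module _ (F : Field c ℓ) where
  open Field F
  open SemiringSum semiring using (sum; sum-cong-≋; ∑-distrib-+; *-distribˡ-sum)
  open RingProperties ring using (//-rightDividesʳ)

  coordinateSpace : ℕ → VectorSpace F c ℓ
  coordinateSpace n = record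
    { Carrierᴹ = Vector Carrier n
    ; _≈ᴹ_     = λ x y → ∀ i → x i ≈ y i
    ; _+ᴹ_     = λ x y i → x i + y i
    ; _*ₗ_     = λ a x i → a * x i
    ; _*ᵣ_     = λ x a i → a * x i
    ; 0ᴹ       = λ _ → 0#
    ; -ᴹ_      = λ x i → - x i
    ; isModule = IsModuleFromLeft.isModule {commutativeRing = commutativeRing} record
      { isLeftModule = record
        { isLeftSemimodule = record
          { +ᴹ-isCommutativeMonoid = A.isCommutativeMonoid
          ; isPreleftSemimodule = record
            { *ₗ-cong      = λ a≈b x≈y i → *-cong a≈b (x≈y i)
            ; *ₗ-zeroˡ     = λ x i → zeroˡ (x i)
            ; *ₗ-distribʳ  = λ x a b i → distribʳ (x i) a b
            ; *ₗ-identityˡ = λ x i → *-identityˡ (x i)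
            ; *ₗ-assoc     = λ a b x i → *-assoc a b (x i)
            ; *ₗ-zeroʳ     = λ a i → zeroʳ a
            ; *ₗ-distribˡ  = λ a x y i → distribˡ a (x i) (y i)
            }
          }
        ; -ᴹ‿cong    = A.⁻¹-cong
        ; -ᴹ‿inverse = A.inverse
        }
      }
    }
    where module A = AbelianGroup (Pointwise.abelianGroup (Fin n) +-abelianGroup)

  private
    open SemiringSolver commutativeSemiring using (solve; _:=_; _:+_; _:*_)

    square : ∀ {n} → Vector Carrier n → Carrier
    square x = sum (λ i → x i * x i)

    dot : ∀ {n} → Vector Carrier n → Vector Carrier n → Carrier
    dot x y = sum (λ i → (x i + x i) * y i)

    square-+ : ∀ {n} (x y : Vector Carrier n) →
               square (λ i → x i + y i) ≈ dot x y + square y + square x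
    square-+ {zero}  x y = sym (trans (+-identityʳ _) (+-identityʳ 0#))
    square-+ {suc n} x y = trans (+-congˡ (square-+ (x ∘ suc) (y ∘ suc)))
      (solve 5 (λ a b s t u →
        (a :+ b) :* (a :+ b) :+ (s :+ t :+ u)
        := ((a :+ a) :* b :+ s) :+ (b :* b :+ t) :+ (a :* a :+ u)) refl _ _ _ _ _)

    polar≈dot : ∀ {n} (x y : Vector Carrier n) →
                square (λ i → x i + y i) - square x - square y ≈ dot x y
    polar≈dot x y = trans
      (+-congʳ (trans (+-congʳ (square-+ x y)) (//-rightDividesʳ (square x) _)))
      (//-rightDividesʳ (square y) _)

    dot-+ : ∀ {n} (x y z : Vector Carrier n) → dot (λ i → x i + y i) z ≈ dot x z + dot y z
    dot-+ x y z = trans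
      (sum-cong-≋ λ i → solve 3 (λ a b d →
        ((a :+ b) :+ (a :+ b)) :* d := (a :+ a) :* d :+ (b :+ b) :* d) refl (x i) (y i) (z i))
      (∑-distrib-+ (λ i → (x i + x i) * z i) (λ i → (y i + y i) * z i))

    dot-* : ∀ {n} a (x y : Vector Carrier n) → dot (λ i → a * x i) y ≈ a * dot x y
    dot-* a x y = trans
      (sum-cong-≋ λ i → solve 3 (λ a b d →
        (a :* b :+ a :* b) :* d := a :* ((b :+ b) :* d)) refl a (x i) (y i))
      (sym (*-distribˡ-sum a (λ i → (x i + x i) * y i)))

    square-* : ∀ {n} a (x : Vector Carrier n) → square (λ i → a * x i) ≈ a * a * square x
    square-* a x = trans
      (sum-cong-≋ λ i → solve 2 (λ a b →
        (a :* b) :* (a :* b) := a :* a :* (b :* b)) refl a (x i))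
      (sym (*-distribˡ-sum (a * a) (λ i → x i * x i)))

  sumOfSquares : ∀ n → QuadraticForm F (coordinateSpace n)
  sumOfSquares n = record
    { ⟦_⟧         = λ x → sum (λ i → x i * x i)
    ; cong        = λ x≈y → sum-cong-≋ λ i → *-cong (x≈y i) (x≈y i)
    ; homogeneous = square-*
    ; polar-+     = λ x y z → trans (polar≈dot _ z)
        (trans (dot-+ x y z) (sym (+-cong (polar≈dot x z) (polar≈dot y z))))
    ; polar-*     = λ a x y → trans (polar≈dot _ y)
        (trans (dot-* a x y) (sym (*-congˡ (polar≈dot x y))))
    }

{-# OPTIONS --safe #-}
module Submission where

open import Defs
open import Algebra.Bundles using (CommutativeRing)
open import Algebra.Solver.Ring.AlmostCommutativeRing using (_-Raw-AlmostCommutative⟶_; fromCommutativeRing)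
import Algebra.Properties.AbelianGroup as AbelianGroupProperties
import Algebra.Properties.Ring as RingProperties
import Algebra.Properties.Semiring.Mult as SemiringMult
import Algebra.Properties.Semiring.Mult.TCOptimised as SemiringMultTC
import Algebra.Properties.Semiring.Sum as SemiringSum
import Algebra.Solver.Ring as RingSolver
import Algebra.Solver.Ring.NaturalCoefficients.Default as SemiringSolver
open import Data.Fin.Base using (Fin; zero; suc; toℕ; fromℕ<; inject≤; join; splitAt; _↑ˡ_; _↑ʳ_)
open import Data.Fin.Properties using (toℕ<n; toℕ-injective; toℕ-fromℕ<; ↑ˡ-injective; ↑ʳ-injective; toℕ-↑ˡ; toℕ-↑ʳ; inject≤-injective; join-splitAt)
open import Data.Integer.Base as ℤ using (ℤ; -[1+_]; _⊖_; _◃_; ∣_∣; sign)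
import Data.Integer.Properties as ℤ
import Data.Maybe.Base as Maybe
open import Data.Nat.Base as ℕ using (ℕ; zero; suc; _≤_; _<_; z≤n; s≤s; z<s; s<s)
import Data.Nat.Properties as ℕ
open import Data.Nat.Divisibility using (_∣_; divides)
open import Data.Product.Base using (∃-syntax; _×_; _,_; proj₁; proj₂)
open import Data.Sign.Base as Sign using (Sign)
open import Data.Sum.Base using (_⊎_; inj₁; inj₂; [_,_]′)
open import Data.Vec.Functional using (Vector; head; tail)
open import Function.Base using (_∘_)
open import Level using (_⊔_)
open import Relation.Binary.PropositionalEquality.Core as ≡ using (_≡_; _≢_)
import Relation.Binary.Reasoning.Setoid as SetoidReasoning
open import Relation.Nullary.Decidable using (yes; no; dec⇒maybe; ¬¬-excluded-middle)
open import Relation.Nullary.Negation using (¬_; contradiction)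

-- After scaling by √2 (the similitude (x , y) ↦ (x + y , x − y) on pairs of
-- coordinates, available because n is even) cliques become families of points
-- at squared distance 2, such as the standard basis e_0 , …. Reflections move
-- any n such points onto the basis. A further point is then equidistant from
-- all e_i, so it is t (1, …, 1) with n t² − 2 t − 1 = 0, that is
-- (n t − 1)² = n + 1; conversely a square root of n + 1 gives such a t. Two
-- further points would force 2 n + 4 = 0. Equality in F is not decidable, but
-- the upper bounds are negative statements, so case distinctions on it are
-- available under double negation.

-- A ring solver with integer coefficients.

module IntegerCoefficientSolver {c ℓ} (R : CommutativeRing c ℓ) where
  open CommutativeRing R hiding (zero)
  open SemiringMultTC semiring using (×-homo-+; ×1-homo-*; 1+×) renaming (_×_ to _·_)
  open RingProperties ring using (-‿distribˡ-*; -‿distribʳ-*; -‿involutive)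
  open AbelianGroupProperties +-abelianGroup using (⁻¹-∙-comm; ε⁻¹≈ε)
  open SemiringSolver commutativeSemiring using (solve; _:=_; _:+_)
  open SetoidReasoning setoid

  private
    -- With the optimised multiple `_·_`, the numerals 1 and 2 reduce to `1#` and `1# + 1#`, so
    -- solver constants match the terms of a goal definitionally.
    ⟦_⟧ : ℤ → Carrier
    ⟦ ℤ.+ n ⟧    = n · 1#
    ⟦ -[1+ n ] ⟧ = - (suc n · 1#)

    ⊖-homo : ∀ m n → ⟦ m ⊖ n ⟧ ≈ m · 1# - n · 1#
    ⊖-homo zero    zero    = sym (-‿inverseʳ 0#)
    ⊖-homo zero    (suc n) = sym (+-identityˡ _)
    ⊖-homo (suc m) zero    = sym (trans (+-congˡ ε⁻¹≈ε) (+-identityʳ _))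
    ⊖-homo (suc m) (suc n) = begin
      ⟦ suc m ⊖ suc n ⟧                        ≡⟨ ≡.cong ⟦_⟧ (ℤ.[1+m]⊖[1+n]≡m⊖n m n) ⟩
      ⟦ m ⊖ n ⟧                                ≈⟨ ⊖-homo m n ⟩
      m · 1# - n · 1#                          ≈⟨ +-identityˡ _ ⟨
      0# + (m · 1# - n · 1#)                   ≈⟨ +-congʳ (-‿inverseʳ 1#) ⟨
      (1# - 1#) + (m · 1# - n · 1#)            ≈⟨ solve 4 (λ a b d e → (a :+ b) :+ (d :+ e) := (a :+ d) :+ (b :+ e)) refl _ _ _ _ ⟩
      (1# + m · 1#) + (- 1# - n · 1#)          ≈⟨ +-congˡ (⁻¹-∙-comm 1# _) ⟩
      (1# + m · 1#) - (1# + n · 1#)            ≈⟨ +-cong (1+× m 1#) (-‿cong (1+× n 1#)) ⟨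
      suc m · 1# - suc n · 1#                  ∎

    +-homo : ∀ i j → ⟦ i ℤ.+ j ⟧ ≈ ⟦ i ⟧ + ⟦ j ⟧
    +-homo (ℤ.+ m)    (ℤ.+ n)  = ×-homo-+ 1# m n
    +-homo (ℤ.+ m)    -[1+ n ] = ⊖-homo m (suc n)
    +-homo -[1+ m ]   (ℤ.+ n)  = trans (⊖-homo n (suc m)) (+-comm _ _)
    +-homo -[1+ m ] -[1+ n ] = begin
      - (suc (suc (m ℕ.+ n)) · 1#)       ≡⟨ ≡.cong (λ k → - (suc k · 1#)) (ℕ.+-suc m n) ⟨
      - ((suc m ℕ.+ suc n) · 1#)         ≈⟨ -‿cong (×-homo-+ 1# (suc m) (suc n)) ⟩
      - (suc m · 1# + suc n · 1#)        ≈⟨ ⁻¹-∙-comm _ _ ⟨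
      - (suc m · 1#) - suc n · 1#        ∎

    signed : Sign → Carrier → Carrier
    signed Sign.+ x = x
    signed Sign.- x = - x

    signed-* : ∀ s t x y → signed (s Sign.* t) (x * y) ≈ signed s x * signed t y
    signed-* Sign.+ Sign.+ x y = refl
    signed-* Sign.+ Sign.- x y = -‿distribʳ-* x y
    signed-* Sign.- Sign.+ x y = -‿distribˡ-* x y
    signed-* Sign.- Sign.- x y = trans (sym (-‿involutive _))
      (trans (-‿cong (-‿distribʳ-* x y)) (-‿distribˡ-* x (- y)))

    ◃-homo : ∀ s n → ⟦ s ◃ n ⟧ ≈ signed s (n · 1#)
    ◃-homo Sign.+ zero    = refl
    ◃-homo Sign.- zero    = sym ε⁻¹≈ε
    ◃-homo Sign.+ (suc n) = refl
    ◃-homo Sign.- (suc n) = refl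

    signed-∣∣ : ∀ i → signed (sign i) (∣ i ∣ · 1#) ≈ ⟦ i ⟧
    signed-∣∣ (ℤ.+ n)  = refl
    signed-∣∣ -[1+ n ] = refl

    *-homo : ∀ i j → ⟦ i ℤ.* j ⟧ ≈ ⟦ i ⟧ * ⟦ j ⟧
    *-homo i j = begin
      ⟦ sign i Sign.* sign j ◃ ∣ i ∣ ℕ.* ∣ j ∣ ⟧                     ≈⟨ ◃-homo (sign i Sign.* sign j) (∣ i ∣ ℕ.* ∣ j ∣) ⟩
      signed (sign i Sign.* sign j) ((∣ i ∣ ℕ.* ∣ j ∣) · 1#)         ≈⟨ signed-cong (sign i Sign.* sign j) (×1-homo-* ∣ i ∣ ∣ j ∣) ⟩
      signed (sign i Sign.* sign j) ((∣ i ∣ · 1#) * (∣ j ∣ · 1#))    ≈⟨ signed-* (sign i) (sign j) _ _ ⟩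
      signed (sign i) (∣ i ∣ · 1#) * signed (sign j) (∣ j ∣ · 1#)    ≈⟨ *-cong (signed-∣∣ i) (signed-∣∣ j) ⟩
      ⟦ i ⟧ * ⟦ j ⟧                                                  ∎
      where
      signed-cong : ∀ s {x y} → x ≈ y → signed s x ≈ signed s y
      signed-cong Sign.+ eq = eq
      signed-cong Sign.- eq = -‿cong eq

    -‿homo : ∀ i → ⟦ ℤ.- i ⟧ ≈ - ⟦ i ⟧
    -‿homo (ℤ.+ zero)  = sym ε⁻¹≈ε
    -‿homo (ℤ.+ suc n) = refl
    -‿homo -[1+ n ]    = sym (-‿involutive _)

    -- Coefficients live in ℤ because the solver compares them, and equality in `R` need not be
    -- decidable.
    morphism : ℤ.+-*-rawRing -Raw-AlmostCommutative⟶ fromCommutativeRing R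
    morphism = record
      { ⟦_⟧    = ⟦_⟧
      ; +-homo = +-homo
      ; *-homo = *-homo
      ; -‿homo = -‿homo
      ; 0-homo = refl
      ; 1-homo = refl
      }

  open RingSolver ℤ.+-*-rawRing (fromCommutativeRing R) morphism
    (λ i j → Maybe.map (reflexive ∘ ≡.cong ⟦_⟧) (dec⇒maybe (i ℤ.≟ j))) public

module SumOfSquares {c ℓ} (F : Field c ℓ) where
  open Field F hiding (zero)
  open SemiringSum semiring using (sum; sum-cong-≋; *-distribˡ-sum)
  open IntegerCoefficientSolver commutativeRing using (Polynomial; solve; con; _:=_; _:+_; _:*_; _:-_; :-_)
  open AbelianGroupProperties +-abelianGroup using (x≈y⇒x∙y⁻¹≈ε)

  private
    variable
      n : ℕ

    :0 :1 :2 : ∀ {k} → Polynomial k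
    :0 = con (ℤ.+ 0)
    :1 = con (ℤ.+ 1)
    :2 = con (ℤ.+ 2)

  -- Dot products, squared distances and the standard basis.

  2# : Carrier
  2# = 1# + 1#

  -- Reduces an equation that holds modulo a hypothesis to a polynomial identity with cofactor `u`.
  -- Nested calls use several hypotheses; the innermost argument is left to the solver.
  modulo : ∀ {l r a b} u → l ≈ r → a ≈ b + u * (l - r) → a ≈ b
  modulo u l≈r eq = trans eq
    (trans (+-congˡ (trans (*-congˡ (x≈y⇒x∙y⁻¹≈ε l≈r)) (zeroʳ u))) (+-identityʳ _))

  dot : Vector Carrier n → Vector Carrier n → Carrier
  dot x y = sum λ i → x i * y i

  norm : Vector Carrier n → Carrier
  norm x = dot x x

  dist : Vector Carrier n → Vector Carrier n → Carrier
  dist x y = norm λ i → x i - y i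

  dot-cong : {x x′ y y′ : Vector Carrier n} →
             (∀ i → x i ≈ x′ i) → (∀ i → y i ≈ y′ i) → dot x y ≈ dot x′ y′
  dot-cong x≈x′ y≈y′ = sum-cong-≋ λ i → *-cong (x≈x′ i) (y≈y′ i)

  dot-comm : (x y : Vector Carrier n) → dot x y ≈ dot y x
  dot-comm x y = sum-cong-≋ λ i → *-comm (x i) (y i)

  dist-cong : {x x′ y y′ : Vector Carrier n} →
              (∀ i → x i ≈ x′ i) → (∀ i → y i ≈ y′ i) → dist x y ≈ dist x′ y′
  dist-cong x≈x′ y≈y′ = dot-cong x-y≈x′-y′ x-y≈x′-y′
    where x-y≈x′-y′ = λ i → +-cong (x≈x′ i) (-‿cong (y≈y′ i))

  dot-linearʳ : ∀ a (x y z : Vector Carrier n) → dot x (λ i → a * y i - z i) ≈ a * dot x y - dot x z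
  dot-linearʳ {zero}  a x y z = solve 1 (λ a → :0 := a :* :0 :- :0) refl a
  dot-linearʳ {suc n} a x y z = trans (+-congˡ (dot-linearʳ a (tail x) (tail y) (tail z)))
    (solve 6 (λ a x y z s t → x :* (a :* y :- z) :+ (a :* s :- t) := a :* (x :* y :+ s) :- (x :* z :+ t))
      refl a (head x) (head y) (head z) _ _)

  dist-expand : (x y : Vector Carrier n) → dist x y ≈ (norm x + norm y) - 2# * dot x y
  dist-expand {zero}  x y = solve 0 (:0 := (:0 :+ :0) :- :2 :* :0) refl
  dist-expand {suc n} x y = trans (+-congˡ (dist-expand (tail x) (tail y)))
    (solve 5 (λ x y s t u →
      (x :- y) :* (x :- y) :+ ((s :+ t) :- :2 :* u) :=
      ((x :* x :+ s) :+ (y :* y :+ t)) :- :2 :* (x :* y :+ u))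
      refl (head x) (head y) _ _ _)

  dist-self : (x : Vector Carrier n) → dist x x ≈ 0#
  dist-self x = trans (dist-expand x x) (solve 1 (λ a → (a :+ a) :- :2 :* a := :0) refl _)

  dist-sym : (x y : Vector Carrier n) → dist x y ≈ dist y x
  dist-sym x y = sum-cong-≋ λ i →
    solve 2 (λ a b → (a :- b) :* (a :- b) := (b :- a) :* (b :- a)) refl (x i) (y i)

  -- For a reflection with normal `w`, the multiples `a` and `b` are the displacements of `x` and
  -- `y`.
  dist-shift : ∀ a b (x y w : Vector Carrier n) →
    dist (λ i → x i - a * w i) (λ i → y i - b * w i) ≈
    (dist x y - 2# * (a - b) * (dot x w - dot y w)) + (a - b) * (a - b) * norm w
  dist-shift {zero}  a b x y w = solve 2 (λ a b →
    :0 := (:0 :- :2 :* (a :- b) :* (:0 :- :0)) :+ (a :- b) :* (a :- b) :* :0) refl a b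
  dist-shift {suc n} a b x y w = trans (+-congˡ (dist-shift a b (tail x) (tail y) (tail w)))
    (solve 9 (λ a b x y w d s t u →
      ((x :- a :* w) :- (y :- b :* w)) :* ((x :- a :* w) :- (y :- b :* w)) :+
      ((d :- :2 :* (a :- b) :* (s :- t)) :+ (a :- b) :* (a :- b) :* u) :=
      (((x :- y) :* (x :- y) :+ d) :- :2 :* (a :- b) :* ((x :* w :+ s) :- (y :* w :+ t))) :+
      (a :- b) :* (a :- b) :* (w :* w :+ u))
      refl a b (head x) (head y) (head w) _ _ _ _)

  dist-scale : ∀ a (x y : Vector Carrier n) → dist (λ i → a * x i) (λ i → a * y i) ≈ a * a * dist x y
  dist-scale a x y = trans
    (sum-cong-≋ λ i → solve 3 (λ a x y →
      (a :* x :- a :* y) :* (a :* x :- a :* y) := a :* a :* ((x :- y) :* (x :- y))) refl a (x i) (y i))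
    (sym (*-distribˡ-sum (a * a) λ i → (x i - y i) * (x i - y i)))

  basis : Fin n → Vector Carrier n
  basis zero    zero    = 1#
  basis zero    (suc j) = 0#
  basis (suc i) zero    = 0#
  basis (suc i) (suc j) = basis i j

  basis-diag : (i : Fin n) → basis i i ≡ 1#
  basis-diag zero    = ≡.refl
  basis-diag (suc i) = basis-diag i

  basis-off-diag : {i j : Fin n} → i ≢ j → basis i j ≡ 0#
  basis-off-diag {i = zero}  {zero}  i≢j = contradiction ≡.refl i≢j
  basis-off-diag {i = zero}  {suc j} i≢j = ≡.refl
  basis-off-diag {i = suc i} {zero}  i≢j = ≡.refl
  basis-off-diag {i = suc i} {suc j} i≢j = basis-off-diag (i≢j ∘ ≡.cong suc)

  dot-zeroʳ : (x y : Vector Carrier n) → (∀ i → y i ≈ 0#) → dot x y ≈ 0#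
  dot-zeroʳ {zero}  x y y≈0 = refl
  dot-zeroʳ {suc n} x y y≈0 =
    trans (+-cong (trans (*-congˡ (y≈0 zero)) (zeroʳ _)) (dot-zeroʳ (tail x) (tail y) (y≈0 ∘ suc)))
          (+-identityʳ 0#)

  dot-basis : (x : Vector Carrier n) (i : Fin n) → dot x (basis i) ≈ x i
  dot-basis x zero    = trans (+-cong (*-identityʳ _) (dot-zeroʳ (tail x) (λ _ → 0#) λ _ → refl)) (+-identityʳ _)
  dot-basis x (suc i) = trans (+-cong (zeroʳ _) (dot-basis (tail x) i)) (+-identityˡ _)

  dist-basis : (x : Vector Carrier n) (i : Fin n) → dist x (basis i) ≈ (norm x + 1#) - 2# * x i
  dist-basis x i = trans (dist-expand x (basis i))
    (+-cong (+-congˡ (trans (dot-basis (basis i) i) (reflexive (basis-diag i))))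
            (-‿cong (*-congˡ (dot-basis x i))))

  dist-bases : {i j : Fin n} → i ≢ j → dist (basis i) (basis j) ≈ 2#
  dist-bases {i = i} {j} i≢j = trans (dist-basis (basis i) j)
    (trans (+-cong (+-congʳ (trans (dot-basis (basis i) i) (reflexive (basis-diag i))))
                   (-‿cong (*-congˡ (reflexive (basis-off-diag i≢j)))))
           (solve 0 ((:1 :+ :1) :- :2 :* :0 := :2) refl))

  -- Leaving `x` free beyond `k` covers both constant vectors (`k = n`) and products with
  -- `leading k`.
  dot-leading : ∀ k (x y : Vector Carrier n) s t → k ≤ n →
                (∀ i → toℕ i < k → x i ≈ s) → (∀ i → toℕ i < k → y i ≈ t) →
                (∀ i → k ≤ toℕ i → y i ≈ 0#) →
                dot x y ≈ natural F k * (s * t)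
  dot-leading zero    x y s t _         _   _   y≈0 = trans (dot-zeroʳ x y λ i → y≈0 i z≤n) (sym (zeroˡ _))
  dot-leading (suc k) x y s t (s≤s k≤n) x≈s y≈t y≈0 = trans
    (+-cong (*-cong (x≈s zero z<s) (y≈t zero z<s))
            (dot-leading k (tail x) (tail y) s t k≤n
              (λ i → x≈s (suc i) ∘ s<s) (λ i → y≈t (suc i) ∘ s<s) (λ i → y≈0 (suc i) ∘ s≤s)))
    (solve 2 (λ p a → p :+ a :* p := (:1 :+ a) :* p) refl (s * t) (natural F k))

  dot-constant : (x y : Vector Carrier n) → ∀ s t → (∀ i → x i ≈ s) → (∀ i → y i ≈ t) →
                 dot x y ≈ natural F n * (s * t)
  dot-constant {n} x y s t x≈s y≈t = dot-leading n x y s t ℕ.≤-refl (λ i _ → x≈s i) (λ i _ → y≈t i)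
    λ i n≤i → contradiction (toℕ<n i) (ℕ.≤⇒≯ n≤i)

  leading : ℕ → Vector Carrier n
  leading zero    i       = 0#
  leading (suc k) zero    = 1#
  leading (suc k) (suc i) = leading k i

  leading-< : ∀ k (i : Fin n) → toℕ i < k → leading k i ≡ 1#
  leading-< (suc k) zero    _         = ≡.refl
  leading-< (suc k) (suc i) (s<s i<k) = leading-< k i i<k

  leading-≥ : ∀ k (i : Fin n) → k ≤ toℕ i → leading k i ≡ 0#
  leading-≥ zero    i       _         = ≡.refl
  leading-≥ (suc k) (suc i) (s≤s k≤i) = leading-≥ k i k≤i

  -- The similitude by √2, reflections and equilateral simplices.

  rotate : ∀ q → Vector Carrier (q ℕ.* 2) → Vector Carrier (q ℕ.* 2)
  rotate (suc q) x zero          = x zero + x (suc zero)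
  rotate (suc q) x (suc zero)    = x zero - x (suc zero)
  rotate (suc q) x (suc (suc i)) = rotate q (tail (tail x)) i

  dist-rotate : ∀ q x y → dist (rotate q x) (rotate q y) ≈ 2# * dist x y
  dist-rotate zero    x y = sym (zeroʳ 2#)
  dist-rotate (suc q) x y = trans (+-congˡ (+-congˡ (dist-rotate q (tail (tail x)) (tail (tail y)))))
    (solve 5 (λ a b c d s →
      ((a :+ b) :- (c :+ d)) :* ((a :+ b) :- (c :+ d)) :+
      (((a :- b) :- (c :- d)) :* ((a :- b) :- (c :- d)) :+ :2 :* s) :=
      :2 :* ((a :- c) :* (a :- c) :+ ((b :- d) :* (b :- d) :+ s)))
      refl (x zero) (x (suc zero)) (y zero) (y (suc zero)) _)

  -- The map x ↦ x − scale · offset x · normal; affine makes it the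
  -- orthogonal reflection in the hyperplane offset = 0.

  record Reflection (n : ℕ) : Set (c ⊔ ℓ) where
    field
      normal : Vector Carrier n
      scale  : Carrier
      unit   : scale * norm normal ≈ 1#
      offset : Vector Carrier n → Carrier
      affine : ∀ x y → offset x - offset y ≈ 2# * (dot x normal - dot y normal)

    reflect : Vector Carrier n → Vector Carrier n
    reflect x i = x i - scale * offset x * normal i

    dist-reflect : ∀ x y → dist (reflect x) (reflect y) ≈ dist x y
    dist-reflect x y = trans
      (dist-shift (scale * offset x) (scale * offset y) x y normal)
      (trans (+-cong (+-congˡ (-‿cong (*-congʳ (*-congˡ diff)))) (*-congʳ (*-cong diff diff)))
        -- With r = `scale` and N = `norm normal`, the change in distance is -4rδ² + 4r²δ²N =
        -- 4rδ²(rN - 1), which `unit` kills.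
        (modulo (2# * 2# * scale * δ * δ) unit
          (solve 4 (λ r d D N →
            (D :- :2 :* (r :* (:2 :* d)) :* d) :+ (r :* (:2 :* d)) :* (r :* (:2 :* d)) :* N :=
            D :+ :2 :* :2 :* r :* d :* d :* (r :* N :- :1))
            refl scale δ (dist x y) (norm normal))))
      where
      δ = dot x normal - dot y normal

      diff : scale * offset x - scale * offset y ≈ scale * (2# * δ)
      diff = trans (solve 3 (λ r a b → r :* a :- r :* b := r :* (a :- b)) refl _ _ _) (*-congˡ (affine x y))

    reflect-fixed : ∀ x → offset x ≈ 0# → ∀ i → reflect x i ≈ x i
    reflect-fixed x off i = modulo (- (scale * normal i)) off
      (solve 4 (λ x r f w → x :- r :* f :* w := x :+ (:- (r :* w)) :* (f :- :0)) refl _ _ _ _)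

  -- Writing the offset as a difference of squared distances makes points equidistant from `a` and
  -- `b` visibly fixed, and gives `dist a b`, the quantity inverted by `scale`, at `a`. Distinctness
  -- of `a` and `b` would not suffice, since `a - b` may be isotropic.
  bisector : (a b : Vector Carrier n) → dist a b ≉ 0# → Reflection n
  bisector a b a≁b = record
    { normal = λ i → a i - b i
    ; scale  = proj₁ inverse
    ; unit   = proj₁ (proj₂ inverse)
    ; offset = λ x → dist x b - dist x a
    ; affine = λ x y → trans
        (+-cong (+-cong (dist-expand x b) (-‿cong (dist-expand x a)))
                (-‿cong (+-cong (dist-expand y b) (-‿cong (dist-expand y a)))))
        (trans
          (solve 8 (λ X Y A B xa xb ya yb →
            (((X :+ B) :- :2 :* xb) :- ((X :+ A) :- :2 :* xa)) :- (((Y :+ B) :- :2 :* yb) :- ((Y :+ A) :- :2 :* ya)) :=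
            :2 :* ((:1 :* xa :- xb) :- (:1 :* ya :- yb)))
            refl (norm x) (norm y) (norm a) (norm b) (dot x a) (dot x b) (dot y a) (dot y b))
          (*-congˡ (sym (+-cong (dot-minusʳ x) (-‿cong (dot-minusʳ y))))))
    }
    where
    inverse = invertible a≁b

    dot-minusʳ : ∀ x → dot x (λ i → a i - b i) ≈ 1# * dot x a - dot x b
    dot-minusʳ x = trans (dot-cong (λ _ → refl) λ i → +-congʳ (sym (*-identityˡ (a i)))) (dot-linearʳ 1# x a b)

  bisector-reflects : (a b : Vector Carrier n) (a≁b : dist a b ≉ 0#) →
                      ∀ i → Reflection.reflect (bisector a b a≁b) a i ≈ b i
  bisector-reflects a b a≁b i = trans (+-congˡ (-‿cong (*-congʳ (trans (*-congˡ offset≈) unit))))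
    (solve 2 (λ a b → a :- :1 :* (a :- b) := b) refl (a i) (b i))
    where
    open Reflection (bisector a b a≁b) using (unit)

    offset≈ : dist a b - dist a a ≈ dist a b
    offset≈ = modulo (- 1#) (dist-self a) (solve 2 (λ d e → d :- e := d :+ (:- :1) :* (e :- :0)) refl _ _)

  -- A record, so that the vertices can be inferred from the type.

  record Simplex {l d} (p : Fin l → Vector Carrier d) : Set ℓ where
    constructor equilateral
    field
      sides : ∀ {i j} → i ≢ j → dist (p i) (p j) ≈ 2#

  open Simplex

  basis-simplex : Simplex (basis {n})
  basis-simplex = equilateral dist-bases

  reflect-simplex : ∀ {l d} (R : Reflection d) {p : Fin l → Vector Carrier d} →
                    Simplex p → Simplex (Reflection.reflect R ∘ p)
  reflect-simplex R simplex = equilateral λ i≢j → trans (Reflection.dist-reflect R _ _) (sides simplex i≢j)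

  module _ (char0 : HasCharacteristicZero F) where
    open SemiringMult semiring using (×1-homo-*)

    natural≉0 : ∀ k → natural F (suc k) ≉ 0#
    natural≉0 k eq with char0 (suc k) eq
    ... | ()

    private
      ½-inverse = invertible {2#} λ 2≈0 → natural≉0 1 (trans (+-congˡ (+-identityʳ 1#)) 2≈0)

    ½ : Carrier
    ½ = proj₁ ½-inverse

    ½*2 : ½ * 2# ≈ 1#
    ½*2 = proj₁ (proj₂ ½-inverse)

    2*-cancelˡ : ∀ {a b} → 2# * a ≈ 2# * b → a ≈ b
    2*-cancelˡ {a} {b} eq = modulo ½ eq
      (modulo (b - a) ½*2
        (solve 3 (λ h a b → a := (b :+ h :* (:2 :* a :- :2 :* b)) :+ (b :- a) :* (h :* :2 :- :1)) refl ½ a b))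

    -- Moving the first `d` points of a simplex onto the standard basis.

    module _ {n m : ℕ} where
      private
        d = suc n

      -- The `m` excess points are never aligned; they are carried along by the isometries.
      Aligned : ℕ → (Fin (d ℕ.+ m) → Vector Carrier d) → Set ℓ
      Aligned k p = ∀ i → toℕ i < k → ∀ j → p (i ↑ˡ m) j ≈ basis i j

      reflect-aligned : ∀ {k p} (R : Reflection d) → let open Reflection R in Aligned k p →
                        (∀ i → toℕ i < k → offset (p (i ↑ˡ m)) ≈ 0#) → Aligned k (reflect ∘ p)
      reflect-aligned R aligned off i i<k j =
        trans (Reflection.reflect-fixed R _ (off i i<k) j) (aligned i i<k j)

      ↑ˡ-≢ : {i j : Fin d} → toℕ i < toℕ j → i ↑ˡ m ≢ j ↑ˡ m
      ↑ˡ-≢ i<j eq = ℕ.<⇒≢ i<j (≡.cong toℕ (↑ˡ-injective m _ _ eq))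

      module _ {k : ℕ} {p : Fin (d ℕ.+ m) → Vector Carrier d} (simplex : Simplex p) (aligned : Aligned k p) where

        -- This is the expansion of `dist (p x) (basis i) ≈ 2#`. The right side does not depend on
        -- `i`, so the first `k` coordinates of a point that is not yet aligned agree.
        equidistant : ∀ {x} i → toℕ i < k → x ≢ i ↑ˡ m → 2# * p x i ≈ norm (p x) - 1#
        equidistant {x} i i<k x≢i = sym (modulo 1#
          (trans (trans (sym (dist-basis (p x) i)) (dist-cong {x = p x} (λ _ → refl) (λ j → sym (aligned i i<k j))))
                 (sides simplex x≢i))
          (solve 2 (λ N a → N :- :1 := :2 :* a :+ :1 :* (((N :+ :1) :- :2 :* a) :- :2)) refl (norm (p x)) (p x i)))

        -- Every aligned point e_i is at squared distance 2 from both the old point and e_κ, so it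
        -- lies on their bisector and stays fixed.
        align-next : ∀ κ → toℕ κ ≡ k → dist (p (κ ↑ˡ m)) (basis κ) ≉ 0# →
                     ∃[ p′ ] Simplex p′ × Aligned (suc k) p′
        align-next κ ≡.refl a≁b = reflect ∘ p , reflect-simplex R simplex , aligned′
          where
          a = p (κ ↑ˡ m)
          R = bisector a (basis κ) a≁b
          open Reflection R using (reflect)

          off : ∀ i → toℕ i < toℕ κ → dist (p (i ↑ˡ m)) (basis κ) - dist (p (i ↑ˡ m)) a ≈ 0#
          off i i<κ = x≈y⇒x∙y⁻¹≈ε (trans
            (trans (dist-cong {y = basis κ} (aligned i i<κ) λ _ → refl) (dist-bases (ℕ.<⇒≢ i<κ ∘ ≡.cong toℕ)))
            (sym (sides simplex (↑ˡ-≢ i<κ))))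

          aligned′ : Aligned (suc (toℕ κ)) (reflect ∘ p)
          aligned′ i i<1+κ with ℕ.m<1+n⇒m<n∨m≡n i<1+κ
          ... | inj₁ i<κ = reflect-aligned {p = p} R aligned off i i<κ
          ... | inj₂ i≡κ with ≡.refl ← toℕ-injective i≡κ = bisector-reflects a (basis κ) a≁b

      -- If the point to be aligned differs from its target by an isotropic
      -- vector, reflect along w = K e_κ − (e_0 + … + e_{K−1}) first, where K points are aligned.
      -- This fixes them and makes K times the squared distance to e_κ equal 4 (K + 1).

      deflect : ∀ {k p} → Simplex p → Aligned (suc k) p → ∀ κ → toℕ κ ≡ suc k →
                dist (p (κ ↑ˡ m)) (basis κ) ≈ 0# →
                ∃[ p′ ] Simplex p′ × Aligned (suc k) p′ × dist (p′ (κ ↑ˡ m)) (basis κ) ≉ 0#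
      deflect {k} {p} simplex aligned κ κ≡ isotropic =
        reflect ∘ p , simplex′ , aligned′ , anisotropic
        where
        K = natural F (suc k)
        K+1 = natural F (suc (suc k))

        <κ : ∀ i → toℕ i < suc k → toℕ i < toℕ κ
        <κ i i<k = ≡.subst (toℕ i <_) (≡.sym κ≡) i<k

        w : Vector Carrier d
        w j = K * basis κ j - leading (suc k) j

        w-κ : w κ ≈ K
        w-κ = trans (+-cong (*-congˡ (reflexive (basis-diag κ)))
                            (-‿cong (reflexive (leading-≥ (suc k) κ (ℕ.≤-reflexive (≡.sym κ≡))))))
                    (solve 1 (λ a → a :* :1 :- :0 := a) refl K)

        w-< : ∀ i → toℕ i < suc k → w i ≈ - 1#
        w-< i i<k = trans (+-cong (*-congˡ (reflexive (basis-off-diag λ κ≡i → ℕ.<⇒≢ (<κ i i<k) (≡.cong toℕ (≡.sym κ≡i)))))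
                                  (-‿cong (reflexive (leading-< (suc k) i i<k))))
                          (solve 1 (λ a → a :* :0 :- :1 := :- :1) refl K)

        dot-w : ∀ x s → (∀ i → toℕ i < suc k → x i ≈ s) → dot x w ≈ K * (x κ - s)
        dot-w x s x≈s = trans (dot-linearʳ K x (basis κ) (leading (suc k)))
          (trans (+-cong (*-congˡ (dot-basis x κ))
                         (-‿cong (dot-leading (suc k) x (leading (suc k)) s 1#
                           (≡.subst (_≤ d) κ≡ (ℕ.<⇒≤ (toℕ<n κ))) x≈s
                           (λ i → reflexive ∘ leading-< (suc k) i)
                           (λ i → reflexive ∘ leading-≥ (suc k) i))))
                 (solve 3 (λ K a s → K :* a :- K :* (s :* :1) := K :* (a :- s)) refl K (x κ) s))

        norm-w : norm w ≈ K * K+1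
        norm-w = trans (dot-w w (- 1#) w-<)
          (*-congˡ (trans (+-congʳ w-κ) (solve 1 (λ K → K :- (:- :1) := :1 :+ K) refl K)))

        inverse = invertible λ norm-w≈0 →
          -- The argument is the predecessor to which `suc k * suc (suc k)` unfolds.
          natural≉0 (suc k ℕ.+ k ℕ.* suc (suc k)) (trans (×1-homo-* (suc k) (suc (suc k))) (trans (sym norm-w) norm-w≈0))

        R : Reflection d
        R = record
          { normal = w
          ; scale  = proj₁ inverse
          ; unit   = proj₁ (proj₂ inverse)
          -- The mirror is the hyperplane `dot x w = - 1#`; it contains each aligned e_i because
          -- `w i` is -1 there.
          ; offset = λ x → 2# * dot x w + 2#
          ; affine = λ x y → solve 2 (λ a b → (:2 :* a :+ :2) :- (:2 :* b :+ :2) := :2 :* (a :- b)) refl _ _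
          }

        open Reflection R using (reflect; scale; unit)

        simplex′ : Simplex (reflect ∘ p)
        simplex′ = reflect-simplex R {p} simplex

        aligned′ : Aligned (suc k) (reflect ∘ p)
        aligned′ = reflect-aligned {p = p} R aligned λ i i<k → trans
          (+-congʳ (*-congˡ (trans (dot-cong {y = w} (aligned i i<k) λ _ → refl)
            (trans (dot-comm (basis i) w) (trans (dot-basis w i) (w-< i i<k))))))
          (solve 0 (:2 :* (:- :1) :+ :2 := :0) refl)

        κ≢ : ∀ i → toℕ i < suc k → κ ↑ˡ m ≢ i ↑ˡ m
        κ≢ i i<k = ↑ˡ-≢ (<κ i i<k) ∘ ≡.sym

        x = p (κ ↑ˡ m)

        x-constant : ∀ i → toℕ i < suc k → x i ≈ x zero
        x-constant i i<k = 2*-cancelˡ (trans (equidistant simplex aligned i i<k (κ≢ i i<k))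
          (sym (equidistant simplex aligned zero z<s (κ≢ zero z<s))))

        -- Equidistance from e_0 eliminates the norm of `x`. The family is quantified afresh because
        -- the formula is applied both before and after the reflection.
        dist-basis-κ : ∀ {p} → Simplex p → Aligned (suc k) p → let x = p (κ ↑ˡ m) in
                       dist x (basis κ) ≈ 2# * ((1# + x zero) - x κ)
        dist-basis-κ {p} simplex aligned = trans (dist-basis (p (κ ↑ˡ m)) κ)
          (sym (modulo 1# (equidistant simplex aligned zero z<s (κ≢ zero z<s))
            (solve 3 (λ N a b → :2 :* ((:1 :+ a) :- b) := ((N :+ :1) :- :2 :* b) :+ :1 :* (:2 :* a :- (N :- :1)))
              refl (norm (p (κ ↑ˡ m))) _ _)))

        level : (1# + x zero) - x κ ≈ 0#
        level = 2*-cancelˡ (trans (sym (dist-basis-κ {p} simplex aligned)) (trans isotropic (sym (zeroʳ 2#))))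

        move : Carrier
        move = scale * (2# * dot x w + 2#)

        -- By `level`, `x κ - x zero` is 1, so `dot x w` is K and the offset is 2 (K + 1); `scale`
        -- inverts `norm w`, which is K (K + 1).
        move*norm : K * K+1 * move ≈ 2# * K+1
        move*norm = trans (*-congˡ (*-congˡ (+-congʳ (*-congˡ (dot-w x (x zero) x-constant)))))
          (modulo (2# * K * (x κ - x zero) + 2#) (trans (*-congˡ (sym norm-w)) unit)
            (modulo (- (2# * K)) level
              (solve 4 (λ K r a b →
                K :* (:1 :+ K) :* (r :* (:2 :* (K :* (b :- a)) :+ :2)) :=
                (:2 :* (:1 :+ K) :+ (:2 :* K :* (b :- a) :+ :2) :* (r :* (K :* (:1 :+ K)) :- :1)) :+
                (:- (:2 :* K)) :* (((:1 :+ a) :- b) :- :0))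
                refl K scale (x zero) (x κ))))

        anisotropic : dist (reflect x) (basis κ) ≉ 0#
        anisotropic d≈0 = natural≉0 (suc k) (2*-cancelˡ (trans (sym move*norm) (trans K*K+1*move≈0 (sym (zeroʳ 2#)))))
          where
          -- If the reflected point were still isotropic relative to e_κ, subtracting `level` from
          -- this would leave (K + 1) `move` = 0, so `move*norm` would give 2 (K + 1) = 0.
          level′ : (1# + (x zero - move * w zero)) - (x κ - move * w κ) ≈ 0#
          level′ = 2*-cancelˡ (trans (sym (dist-basis-κ {reflect ∘ p} simplex′ aligned′)) (trans d≈0 (sym (zeroʳ 2#))))

          K*K+1*move≈0 : K * K+1 * move ≈ 0#
          K*K+1*move≈0 = modulo K (trans (sym (+-cong (+-congˡ (+-congˡ (-‿cong (*-congˡ (w-< zero z<s))))) (-‿cong (+-congˡ (-‿cong (*-congˡ w-κ)))))) level′)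
            (modulo (- K) level
              (solve 4 (λ K r a b →
                K :* (:1 :+ K) :* r :=
                (:0 :+ K :* (((:1 :+ (a :- r :* (:- :1))) :- (b :- r :* K)) :- :0)) :+
                (:- K) :* (((:1 :+ a) :- b) :- :0))
                refl K move (x zero) (x κ)))

      -- Induction on `k`. The first point is placed by a translation, which requires no anisotropy
      -- and supplies the aligned point that `deflect` starts from. The double negation comes from
      -- deciding whether the next difference vector is isotropic.
      align : ∀ {p} → Simplex p → ∀ k → k < d → ¬ ¬ (∃[ p′ ] Simplex p′ × Aligned (suc k) p′)
      align {p} simplex zero _ none = none (p′ , simplex′ , aligned′)
        where
        p′ : Fin (d ℕ.+ m) → Vector Carrier d
        p′ i j = p i j + (basis zero j - p zero j)

        simplex′ : Simplex p′
        simplex′ = equilateral λ i≢j → trans (dot-cong (cancel _ _) (cancel _ _)) (sides simplex i≢j)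
          where
          cancel : ∀ i j k → p′ i k - p′ j k ≈ p i k - p j k
          cancel i j k = solve 3 (λ a b t → (a :+ t) :- (b :+ t) := a :- b) refl (p i k) (p j k) _

        aligned′ : Aligned 1 p′
        aligned′ zero    _          j = solve 2 (λ a b → a :+ (b :- a) := b) refl (p zero j) (basis zero j)
        aligned′ (suc i) (s<s ())
      align {p} simplex (suc k) k<d none = align simplex k (ℕ.<⇒≤ k<d) λ (q , simplex , aligned) →
        ¬¬-excluded-middle λ where
          (no  ≉0) → none (align-next simplex aligned κ κ≡ ≉0)
          (yes ≈0) → let (_ , simplex′ , aligned′ , ≉0) = deflect simplex aligned κ κ≡ ≈0 in
                     none (align-next simplex′ aligned′ κ κ≡ ≉0)
        where
        κ  = fromℕ< k<d
        κ≡ = toℕ-fromℕ< k<d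

      -- Points in excess of an aligned basis.

      module _ {p} (simplex : Simplex p) (aligned : Aligned d p) where
        private
          N = natural F d

        module Excess (j : Fin m) where
          point : Vector Carrier d
          point = p (d ↑ʳ j)

          height : Carrier
          height = point zero

          private
            equi : ∀ i → 2# * point i ≈ norm point - 1#
            equi i = equidistant simplex aligned i (toℕ<n i) λ eq →
              ℕ.<⇒≢ (ℕ.<-≤-trans (toℕ<n i) (ℕ.m≤m+n d (toℕ j)))
                (≡.trans (≡.sym (toℕ-↑ˡ i m)) (≡.trans (≡.cong toℕ (≡.sym eq)) (toℕ-↑ʳ d j)))

          constant : ∀ i → point i ≈ height
          constant i = 2*-cancelˡ (trans (equi i) (sym (equi zero)))

          norm-point : norm point ≈ N * (height * height)
          norm-point = dot-constant point point height height constant constant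

          quadratic : N * (height * height) ≈ 2# * height + 1#
          quadratic = trans (sym norm-point) (modulo (- 1#) (equi zero)
            (solve 2 (λ a t → a := (:2 :* t :+ :1) :+ (:- :1) :* (:2 :* t :- (a :- :1))) refl _ _))

        excess-isSquare : Fin m → IsSquare F (natural F (d ℕ.+ 1))
        excess-isSquare j = N * height - 1# , trans
          (modulo N quadratic
            (solve 2 (λ N t → (N :* t :- :1) :* (N :* t :- :1) := (:1 :+ N) :+ N :* (N :* (t :* t) :- (:2 :* t :+ :1)))
              refl N height))
          (reflexive (≡.cong (natural F) (ℕ.+-comm 1 d)))
          where open Excess j

        -- Two excess points t (1, …, 1) and u (1, …, 1) satisfy
        -- N t² = 2t + 1, N u² = 2u + 1 and N (t − u)² = 2, whence 2 N + 4 = 0.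

        excess-unique : ∀ i j → ¬ i ≢ j
        excess-unique i j i≢j = natural≉0 (suc d) (2*-cancelˡ (2*-cancelˡ (trans 4*[N+2]≈0
          (solve 0 (:0 := :2 :* (:2 :* :0)) refl))))
          where
          module I = Excess i
          module J = Excess j
          t = I.height
          u = J.height

          separation : (N * (t * t) + N * (u * u)) - 2# * (N * (t * u)) ≈ 2#
          separation = trans
            (sym (trans (dist-expand I.point J.point)
              (+-cong (+-cong I.norm-point J.norm-point)
                      (-‿cong (*-congˡ (dot-constant I.point J.point t u I.constant J.constant))))))
            (sides simplex (i≢j ∘ ↑ʳ-injective d i j))

          4*[N+2]≈0 : 2# * (2# * (1# + (1# + N))) ≈ 0#
          4*[N+2]≈0 =
            -- Let A and B be left minus right side of the two quadratics, and X = N (t - u)². Then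
            -- A - B = (t - u)(N (t + u) - 2), and the first two cofactors assemble N (t - u)(N (t +
            -- u) - 2)(A - B) - 2 N X (A + B) = X (4 + 4 N - N X). At X = 2 this is 4 (N + 2); the
            -- third cofactor accounts for X - 2.
            modulo ((N * N * (t - u) * (u + u + u - t)) - 2# * N * (t - u)) I.quadratic
              (modulo ((N * N * (t - u) * (u - (t + t + t))) + 2# * N * (t - u)) J.quadratic
                (modulo (N * N * (t - u) * (t - u) - 2# * (N + 2#)) separation
                  (solve 3 (λ N t u →
                    :2 :* (:2 :* (:1 :+ (:1 :+ N))) :=
                    ((:0 :+ ((N :* N :* (t :- u) :* (u :+ u :+ u :- t)) :- :2 :* N :* (t :- u)) :*
                      (N :* (t :* t) :- (:2 :* t :+ :1))) :+
                     ((N :* N :* (t :- u) :* (u :- (t :+ t :+ t))) :+ :2 :* N :* (t :- u)) :*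
                      (N :* (u :* u) :- (:2 :* u :+ :1))) :+
                    (N :* N :* (t :- u) :* (t :- u) :- :2 :* (N :+ :2)) :*
                      (((N :* (t :* t) :+ N :* (u :* u)) :- :2 :* (N :* (t :* u))) :- :2))
                    refl N t u)))

    -- Bounds on simplices, and the simplex with an apex.

    simplex-isSquare : ∀ {n} {p : Fin (suc n ℕ.+ 1) → Vector Carrier (suc n)} →
                       Simplex p → ¬ ¬ IsSquare F (natural F (suc n ℕ.+ 1))
    simplex-isSquare {n} simplex none = align simplex n ℕ.≤-refl λ (_ , simplex , aligned) →
      none (excess-isSquare simplex aligned zero)

    no-larger-simplex : ∀ {n} {p : Fin (suc n ℕ.+ 2) → Vector Carrier (suc n)} → ¬ Simplex p
    no-larger-simplex {n} simplex = align simplex n ℕ.≤-refl λ (_ , simplex , aligned) →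
      excess-unique simplex aligned zero (suc zero) λ ()

    basis-apex-simplex : ∀ {n} → IsSquare F (natural F (suc n ℕ.+ 1)) →
                         ∃[ p ] Simplex {suc n ℕ.+ 1} {suc n} p
    basis-apex-simplex {n} (b , b²≈) = vertex ∘ splitAt d , equilateral λ i≢j → vertex-simplex (i≢j ∘ splitAt-injective)
      where
      d = suc n
      N = natural F d

      inverse = invertible (natural≉0 n)
      v = proj₁ inverse
      -- Solves N t - 1 = b, so that N t² - 2 t - 1 = 0 by b² = N + 1.
      t = v * (1# + b)

      apex : Vector Carrier d
      apex _ = t

      splitAt-injective : {i j : Fin (d ℕ.+ 1)} → splitAt d i ≡ splitAt d j → i ≡ j
      splitAt-injective {i} {j} eq =
        ≡.trans (≡.sym (join-splitAt d 1 i)) (≡.trans (≡.cong (join d 1) eq) (join-splitAt d 1 j))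

      apex-basis : ∀ i → dist apex (basis i) ≈ 2#
      apex-basis i = trans (dist-basis apex i)
        (trans (+-congʳ (+-congʳ (dot-constant apex apex t t (λ _ → refl) (λ _ → refl))))
          (modulo v (trans b²≈ (reflexive (≡.cong (natural F) (ℕ.+-comm d 1))))
            (modulo (v * (1# + b) * (1# + b) + 1#) (proj₁ (proj₂ inverse))
              (solve 3 (λ N v b →
                (N :* (v :* (:1 :+ b) :* (v :* (:1 :+ b))) :+ :1) :- :2 :* (v :* (:1 :+ b)) :=
                (:2 :+ v :* (b :* b :- (:1 :+ N))) :+ (v :* (:1 :+ b) :* (:1 :+ b) :+ :1) :* (v :* N :- :1))
                refl N v b))))

      vertex : Fin d ⊎ Fin 1 → Vector Carrier d
      vertex = [ basis , (λ _ → apex) ]′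

      vertex-simplex : ∀ {i j} → i ≢ j → dist (vertex i) (vertex j) ≈ 2#
      vertex-simplex {inj₁ i}    {inj₁ j}    i≢j = dist-bases (i≢j ∘ ≡.cong inj₁)
      vertex-simplex {inj₁ i}    {inj₂ _}    i≢j = trans (dist-sym (basis i) apex) (apex-basis i)
      vertex-simplex {inj₂ _}    {inj₁ j}    i≢j = apex-basis j
      vertex-simplex {inj₂ zero} {inj₂ zero} i≢j = contradiction ≡.refl i≢j

    -- Passage between simplices and cliques.

    module _ (q : ℕ) where
      private
        G = 𝒢 F (sumOfSquares F (q ℕ.* 2)) 1#

      -- `rotate q` applied twice is multiplication by 2, so `½` times `rotate q` is its inverse and
      -- halves squared distances.
      simplex⇒clique : ∀ {l} {p : Fin l → Vector Carrier (q ℕ.* 2)} → Simplex p → Clique G l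
      simplex⇒clique {p = p} simplex = record
        { vertex   = vertex
        -- Coinciding vertices would have squared distance both 0 and 1.
        ; adjacent = λ i≢j → (λ eq → 0≉1 (trans (sym (dist-self (vertex _)))
                               (trans (dist-cong (λ _ → refl) eq) (unit i≢j)))) , unit i≢j
        }
        where
        vertex = λ i j → ½ * rotate q (p i) j

        unit : ∀ {i j} → i ≢ j → dist (vertex i) (vertex j) ≈ 1#
        unit {i} {j} i≢j = trans (dist-scale ½ (rotate q (p i)) (rotate q (p j)))
          (trans (*-congˡ (trans (dist-rotate q (p i) (p j)) (*-congˡ (sides simplex i≢j))))
            (trans (solve 1 (λ h → h :* h :* (:2 :* :2) := (h :* :2) :* (h :* :2)) refl ½)
              (trans (*-cong ½*2 ½*2) (*-identityˡ 1#))))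

      -- Surplus vertices are dropped, so that the bounds for exactly n + 1 and n + 2 points apply
      -- to any larger clique.
      clique⇒simplex : ∀ {k l} → k ≤ l → Clique G l → ∃[ p ] Simplex {k} {q ℕ.* 2} p
      clique⇒simplex k≤l clique = (λ i → rotate q (vertex (inject≤ i k≤l))) , equilateral λ i≢j →
        trans (dist-rotate q _ _)
          (trans (*-congˡ (proj₂ (adjacent (i≢j ∘ inject≤-injective k≤l k≤l _ _)))) (*-identityʳ 2#))
        where open Clique clique

open import Data.Nat.Base using (_+_)

theorem5p4 : ∀ {c ℓ} (F : Field c ℓ) → HasCharacteristicZero F →
    (n : ℕ) → 0 < n → 2 ∣ n →
    (¬ IsSquare F (natural F (n + 1)) → IsCliqueNumber (𝒢 F (sumOfSquares F n) (Field.1# F)) n) ×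
    (IsSquare F (natural F (n + 1)) → IsCliqueNumber (𝒢 F (sumOfSquares F n) (Field.1# F)) (n + 1))
theorem5p4 F char0 n 0<n (divides (suc q) ≡.refl) =
  (λ nonsquare → simplex⇒clique char0 (suc q) basis-simplex , λ {l} clique →
    -- Order on ℕ is decidable, so it is enough to refute `n < l`; the doubly negated square root of
    -- `simplex-isSquare` then suffices.
    ℕ.≮⇒≥ λ n<l →
      let (_ , simplex) = clique⇒simplex char0 (suc q) (≡.subst (_≤ l) (ℕ.+-comm 1 n) n<l) clique
      in simplex-isSquare char0 simplex nonsquare) ,
  (λ square → simplex⇒clique char0 (suc q) (proj₂ (basis-apex-simplex char0 square)) , λ {l} clique →
    ℕ.≮⇒≥ λ n+1<l →
      let (_ , simplex) = clique⇒simplex char0 (suc q) (≡.subst (_≤ l) (≡.sym (ℕ.+-suc n 1)) n+1<l) clique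
      in no-larger-simplex char0 simplex)
  where open SumOfSquares F
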